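{- Let $n,s,k \in \mathbb{N}$ with $n \geqslant \max\left\{ 2\binom{2s}{s}(k-1) + 1,\; 13k - 15 \right\}$. Then $m(n,2s,s,k) = n - 2k + 2$. Moreover, if $r \in \mathbb{N}$ with $2s < r$, then there exists $\varepsilon = \varepsilon(s,r) > 0$ such that $m(n,r,s,k) < (1-\varepsilon)n$ for every sufficiently large $n \in \mathbb{N}$.
   Context: An $r$-colouring of the complete graph $K_n$ ($n \geqslant 2$) is any function $f: E(K_n) \to [r] = \{1,\dots,r\}$. For a subgraph $H \subseteq K_n$, $c_f(H) = |f(E(H))|$ is the number of distinct colours on edges of $H$. A graph on at least $k+1$ vertices is $k$-connected if deleting any at most $k-1$ vertices leaves a connected graph. $M(f,n,r,s,k)$ is the maximum number of vertices of a $k$-connected subgraph $H \subseteq K_n$ with $c_f(H) \leqslant s$ (taken to be $0$ if no such subgraph exists), and $m(n,r,s,k) = \min_f M(f,n,r,s,k)$, the minimum over all $r$-colourings $f$ of $E(K_n)$. -}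

module Defs where

open import Data.Nat using (ℕ; zero; suc; _+_; _*_; _∸_; _≤_; _<_)
open import Data.Bool using (Bool; T)
open import Data.Fin using (Fin)
open import Data.Fin.Properties using (any?) renaming (_≟_ to _≟F_)
open import Data.Fin.Subset using (Subset; _∈_; _∉_; _⊆_; ∣_∣)
open import Data.Vec using (tabulate)
open import Data.Product using (Σ; ∃; _×_; _,_)
open import Data.Sum using (_⊎_)
open import Relation.Nullary using (¬_)
open import Relation.Nullary.Decidable using (⌊_⌋; _×-dec_)
open import Relation.Binary.PropositionalEquality using (_≡_; _≢_)
open import Data.Bool.Properties using (T?)

-- An r-colouring of E(K_n): a symmetric function on pairs of distinct
-- vertices of Fin n with values in Fin r (colours [r] ≅ Fin r).
-- Values on the diagonal (i , i) are never used (K_n has no loops).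
record Colouring (n r : ℕ) : Set where
  field
    col  : Fin n → Fin n → Fin r
    sym  : ∀ i j → col i j ≡ col j i
open Colouring public

record Subgraph (n : ℕ) : Set where
  field
    V      : Subset n
    E      : Fin n → Fin n → Bool
    E-sym  : ∀ i j → T (E i j) → T (E j i)
    E-irr  : ∀ i j → T (E i j) → i ≢ j
    E-inV  : ∀ i j → T (E i j) → (i ∈ V) × (j ∈ V)
open Subgraph public

∣V∣ : ∀ {n} → Subgraph n → ℕ
∣V∣ H = ∣ V H ∣

usedColours : ∀ {n r} → Colouring n r → Subgraph n → Subset r
usedColours f H = tabulate λ c →
  ⌊ any? (λ i → any? (λ j → T? (E H i j) ×-dec (col f i j ≟F c))) ⌋

c[_] : ∀ {n r} → Colouring n r → Subgraph n → ℕ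
c[ f ] H = ∣ usedColours f H ∣

data Reach {n} (H : Subgraph n) (S : Subset n) : Fin n → Fin n → Set where
  here : ∀ {u} → u ∈ V H → u ∉ S → Reach H S u u
  step : ∀ {u w v} → u ∈ V H → u ∉ S → T (E H u w) → Reach H S w v → Reach H S u v

ConnectedMinus : ∀ {n} → Subgraph n → Subset n → Set
ConnectedMinus H S = ∀ u v → u ∈ V H → u ∉ S → v ∈ V H → v ∉ S → Reach H S u v

KConnected : ∀ {n} → ℕ → Subgraph n → Set
KConnected {n} k H =
  (suc k ≤ ∣V∣ H) × (∀ (S : Subset n) → S ⊆ V H → ∣ S ∣ < k → ConnectedMinus H S)

Good : ∀ {n r} → Colouring n r → ℕ → ℕ → Subgraph n → Set
Good f s k H = KConnected k H × (c[ f ] H ≤ s)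

-- "M(f,n,r,s,k) = v": v is the maximum number of vertices of an admissible
-- subgraph, with the convention that it is 0 if no admissible subgraph exists.
IsM : ∀ {n r} → Colouring n r → ℕ → ℕ → ℕ → Set
IsM {n} f s k v =
  ((v ≡ 0) ⊎ (Σ (Subgraph n) λ H → Good f s k H × (∣V∣ H ≡ v)))
  × (∀ (H : Subgraph n) → Good f s k H → ∣V∣ H ≤ v)

Ism : ℕ → ℕ → ℕ → ℕ → ℕ → Set
Ism n r s k v =
  (Σ (Colouring n r) λ f → IsM f s k v)
  × (∀ (f : Colouring n r) (w : ℕ) → IsM f s k w → v ≤ w)

{-# OPTIONS --safe #-}

-- Write k = t + 1.
--
-- Lower bound: fix s of the 2s colours and call their edges red, the others blue.  Peel off a set X
-- whose vertices each have at most t red neighbours outside X.  As long as ∣X∣ < 2t, either red is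
-- k-connected outside X, or it has a cut S of size at most t.  If both sides of the cut have more than
-- t vertices, blue is k-connected on the complement of S; otherwise the smaller side is added to X.
-- Once ∣X∣ ≥ 2t, double counting red edges leaves at most 2t vertices outside X with at most t blue
-- neighbours in X, and without them blue is k-connected.
--
-- Upper bound: give every s-set of colours its own class of 2t vertices, and colour so that these
-- vertices have at most t neighbours in those s colours; a k-connected subgraph in these colours then
-- misses the class.  With more than 2s colours, two s-sets never cover all colours, so all vertices can
-- be split evenly into classes which avoid their own s colours completely.
module Submission where

open import Defs renaming (sym to col-sym)
open import Data.Nat renaming (_/_ to _/ℕ_)
open import Data.Nat.Properties
open import Data.Nat.DivMod using (_mod_; m/n≤m; m/n*n≤m; m%n<n; m≡m%n+[m/n]*n; m<n⇒m%n≡m; [m+kn]%n≡m%n; m≥n⇒m/n>0)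
open import Data.Nat.Combinatorics using (_C_; nCk+nC[k+1]≡[n+1]C[k+1]; nCk≡nC[n∸k]; nCn≡1)
open import Data.Bool using (Bool; true; false; T)
open import Data.Bool.Properties using (T?)
open import Data.Fin using (Fin; zero; suc; toℕ; fromℕ<; inject≤; combine; opposite)
open import Data.Fin.Properties using (any?; injective⇒≤; +↔⊎; toℕ-injective; toℕ<n; toℕ-fromℕ<; fromℕ<-injective; inject≤-injective; combine-injective; combine-surjective) renaming (_≟_ to _≟F_; suc-injective to suc-injectiveF)
open import Data.Fin.Subset hiding (_-_)
open import Data.Fin.Subset.Properties
open import Data.Vec using (tabulate; lookup; []; _∷_; here; there)
open import Data.Vec.Properties using (lookup∘tabulate; lookup⇒[]=; []=⇒lookup)
open import Data.Product using (Σ; ∃; _×_; _,_; proj₁; proj₂; Σ-syntax)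
open import Data.Sum using (_⊎_; inj₁; inj₂; [_,_]′)
open import Data.Sum.Function.Propositional using (_⊎-↔_)
open import Data.Empty using (⊥-elim)
open import Function using (_∘_; _↔_; mk↔ₛ′; Inverse)
open import Function.Construct.Composition using (_↔-∘_)
open import Relation.Nullary using (¬_; Dec; yes; no; contradiction)
open import Relation.Nullary.Decidable using (⌊_⌋; _×-dec_; ¬?; toWitness; fromWitness; decidable-stable; map′)
open import Relation.Unary using (Decidable)
open import Relation.Binary.PropositionalEquality hiding ([_])
import Data.Nat.Solver
open import Algebra.Properties.CommutativeMonoid.Sum +-0-commutativeMonoid using (sum; ∑-comm; sum-cong-≗)
open import Data.Integer using (+_)
open import Data.Rational using (ℚ; _/_; 0ℚ; 1ℚ; _-_; toℚᵘ) renaming (_*_ to _*ℚ_; _<_ to _<ℚ_)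
import Data.Integer as ℤ
import Data.Integer.Properties as ℤ
import Data.Rational as ℚ
import Data.Rational.Properties as ℚ
open import Data.Rational.Unnormalised using (ℚᵘ; mkℚᵘ; 1ℚᵘ; *<*; ↥_; ↧_) renaming (_≃_ to _≃ᵘ_)
import Data.Rational.Unnormalised as ℚᵘ
import Data.Rational.Unnormalised.Properties as ℚᵘ

private
  variable
    m n r : ℕ

-- Cardinalities of finite subsets

∣∁p∣+∣p∣≡n : (p : Subset n) → ∣ ∁ p ∣ + ∣ p ∣ ≡ n
∣∁p∣+∣p∣≡n p = trans (cong (_+ ∣ p ∣) (∣∁p∣≡n∸∣p∣ p)) (m∸n+n≡m (∣p∣≤n p))

∣p∪q∣≤∣p∣+∣q∣ : (p q : Subset n) → ∣ p ∪ q ∣ ≤ ∣ p ∣ + ∣ q ∣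
∣p∪q∣≤∣p∣+∣q∣ []            []            = z≤n
∣p∪q∣≤∣p∣+∣q∣ (outside ∷ p) (outside ∷ q) = ∣p∪q∣≤∣p∣+∣q∣ p q
∣p∪q∣≤∣p∣+∣q∣ (outside ∷ p) (inside ∷ q)  =
  ≤-trans (s≤s (∣p∪q∣≤∣p∣+∣q∣ p q)) (≤-reflexive (sym (+-suc ∣ p ∣ ∣ q ∣)))
∣p∪q∣≤∣p∣+∣q∣ (inside ∷ p)  (outside ∷ q) = s≤s (∣p∪q∣≤∣p∣+∣q∣ p q)
∣p∪q∣≤∣p∣+∣q∣ (inside ∷ p)  (inside ∷ q)  =
  s≤s (≤-trans (∣p∪q∣≤∣p∣+∣q∣ p q) (+-monoʳ-≤ ∣ p ∣ (n≤1+n ∣ q ∣)))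

∪-bound : ∀ {a b} (p q : Subset n) → ∣ p ∣ ≤ a → ∣ q ∣ ≤ b → ∣ p ∪ q ∣ ≤ a + b
∪-bound p q p≤a q≤b = ≤-trans (∣p∪q∣≤∣p∣+∣q∣ p q) (+-mono-≤ p≤a q≤b)

∉∪ : ∀ {i : Fin n} (p q : Subset n) → i ∉ p ∪ q → i ∉ p × i ∉ q
∉∪ p q i∉ = (λ i∈p → i∉ (p⊆p∪q q i∈p)) , (λ i∈q → i∉ (q⊆p∪q p q i∈q))

∣p∣<∣q∣⇒∃q∖p : (p q : Subset n) → ∣ p ∣ < ∣ q ∣ → ∃ λ i → i ∈ q × i ∉ p
∣p∣<∣q∣⇒∃q∖p p q lt with any? (λ i → (i ∈? q) ×-dec ¬? (i ∈? p))
... | yes found = found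
... | no none = contradiction (p⊆q⇒∣p∣≤∣q∣ q⊆p) (<⇒≱ lt)
  where
  q⊆p : q ⊆ p
  q⊆p {i} i∈q = decidable-stable (i ∈? p) (λ i∉p → none (i , i∈q , i∉p))

⊆∧∣q∣≤∣p∣⇒≡ : {p q : Subset n} → p ⊆ q → ∣ q ∣ ≤ ∣ p ∣ → p ≡ q
⊆∧∣q∣≤∣p∣⇒≡ {p = p} {q} p⊆q q≤p = ⊆-antisym p⊆q λ {i} i∈q →
  decidable-stable (i ∈? p) (λ i∉p → <⇒≱ (p⊂q⇒∣p∣<∣q∣ (p⊆q , i , i∈q , i∉p)) q≤p)

⟪_⟫ : {P : Fin n → Set} → Decidable P → Subset n
⟪ P? ⟫ = tabulate (λ i → ⌊ P? i ⌋)

module _ {P : Fin n → Set} (P? : Decidable P) where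

  ∈⟪⟫⁺ : ∀ {i} → P i → i ∈ ⟪ P? ⟫
  ∈⟪⟫⁺ {i} Pi = lookup⇒[]= i _ (trans (lookup∘tabulate _ i) (T⇒≡ (fromWitness Pi)))
    where
    T⇒≡ : ∀ {b} → T b → b ≡ true
    T⇒≡ {true} _ = refl

  ∈⟪⟫⁻ : ∀ {i} → i ∈ ⟪ P? ⟫ → P i
  ∈⟪⟫⁻ {i} i∈ = toWitness (subst T (trans (sym ([]=⇒lookup i∈)) (lookup∘tabulate _ i)) _)

image : (g : Fin m → Fin n) → Σ[ p ∈ Subset n ] (∣ p ∣ ≤ m × (∀ j → g j ∈ p))
image {zero}  {n} g = ⊥ , ≤-reflexive (∣⊥∣≡0 n) , λ ()
image {suc m} {n} g with image (g ∘ suc)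
... | p , p≤m , g∈p = ⁅ g zero ⁆ ∪ p , ∪-bound ⁅ g zero ⁆ p (≤-reflexive (∣⁅x⁆∣≡1 (g zero))) p≤m ,
  λ { zero → p⊆p∪q p (x∈⁅x⁆ (g zero)) ; (suc j) → q⊆p∪q ⁅ g zero ⁆ p (g∈p j) }

position : (p : Subset n) {i : Fin n} → i ∈ p → Fin ∣ p ∣
position (inside ∷ p)  here       = zero
position (inside ∷ p)  (there i∈) = suc (position p i∈)
position (outside ∷ p) (there i∈) = position p i∈

position-injective : (p : Subset n) {i j : Fin n} (i∈ : i ∈ p) (j∈ : j ∈ p) →
  position p i∈ ≡ position p j∈ → i ≡ j
position-injective (inside ∷ p)  here       here       eq = refl
position-injective (inside ∷ p)  (there i∈) (there j∈) eq =
  cong suc (position-injective p i∈ j∈ (suc-injectiveF eq))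
position-injective (outside ∷ p) (there i∈) (there j∈) eq =
  cong suc (position-injective p i∈ j∈ eq)

injective⇒≤∣p∣ : (p : Subset n) (g : Fin m → Fin n) → (∀ i j → g i ≡ g j → i ≡ j) →
  (∀ i → g i ∈ p) → m ≤ ∣ p ∣
injective⇒≤∣p∣ p g inj g∈p =
  injective⇒≤ {f = λ i → position p (g∈p i)} (λ {i} {j} eq → inj i j (position-injective p _ _ eq))

-- Serves two purposes: enlarging the used colours of a subgraph to an exact `s`-set, and, starting
-- from `⊥`, producing some `s`-set.
⊆-extend : (p : Subset n) (s : ℕ) → ∣ p ∣ ≤ s → s ≤ n → Σ[ q ∈ Subset n ] (∣ q ∣ ≡ s × p ⊆ q)
⊆-extend [] zero _ _ = [] , refl , λ i∈ → i∈
⊆-extend (inside ∷ p) (suc s) (s≤s p≤s) (s≤s s≤n) with ⊆-extend p s p≤s s≤n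
... | q , ∣q∣≡s , p⊆q = inside ∷ q , cong suc ∣q∣≡s , s⊆s p⊆q
⊆-extend {suc n} (outside ∷ p) s p≤s s≤1+n with s ≤? n
... | yes s≤n with ⊆-extend p s p≤s s≤n
...   | q , ∣q∣≡s , p⊆q = outside ∷ q , ∣q∣≡s , s⊆s p⊆q
⊆-extend {suc n} (outside ∷ p) s p≤s s≤1+n | no s≰n =
  ⊤ , trans (∣⊤∣≡n (suc n)) (≤-antisym (≰⇒> s≰n) s≤1+n) , ⊆-max _

-- Pascal's rule as a bijection: an `s`-set either contains the first element or does not. It lets
-- `Fin (m C s)` index the vertex classes.
subsetsOfSize : ∀ m s → Fin (m C s) ↔ (Σ[ p ∈ Subset m ] ∣ p ∣ ≡ s)
subsetsOfSize m zero = subst (λ N → Fin N ↔ (Σ[ p ∈ Subset m ] ∣ p ∣ ≡ 0)) (sym mC0≡1)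
  (mk↔ₛ′ (λ _ → ⊥ , ∣⊥∣≡0 m) (λ _ → zero) (λ (p , ∣p∣≡0) → lemma p ∣p∣≡0 (∣⊥∣≡0 m)) (λ { zero → refl }))
  where
  mC0≡1 : m C 0 ≡ 1
  mC0≡1 = trans (nCk≡nC[n∸k] {0} {m} z≤n) (nCn≡1 m)
  lemma : ∀ {m} (p : Subset m) (eq : ∣ p ∣ ≡ 0) (eq′ : ∣ ⊥ {m} ∣ ≡ 0) →
    _≡_ {A = Σ[ p ∈ Subset m ] ∣ p ∣ ≡ 0} (⊥ , eq′) (p , eq)
  lemma {m} p eq eq′ with ⊆∧∣q∣≤∣p∣⇒≡ {p = ⊥} {p} (⊆-min p) (≤-trans (≤-reflexive eq) z≤n)
  ... | refl = cong (_ ,_) (≡-irrelevant eq′ eq)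
subsetsOfSize zero    (suc s) = mk↔ₛ′ (λ ()) (λ { ([] , ()) }) (λ { ([] , ()) }) (λ ())
subsetsOfSize (suc m) (suc s) = subst (λ N → Fin N ↔ (Σ[ p ∈ Subset (suc m) ] ∣ p ∣ ≡ suc s)) (nCk+nC[k+1]≡[n+1]C[k+1] m s)
  (mk↔ₛ′ to from to-from from-to
    ↔-∘ ((subsetsOfSize m s ⊎-↔ subsetsOfSize m (suc s)) ↔-∘ +↔⊎))
  where
  to : (Σ[ p ∈ Subset m ] ∣ p ∣ ≡ s) ⊎ (Σ[ p ∈ Subset m ] ∣ p ∣ ≡ suc s) →
       Σ[ p ∈ Subset (suc m) ] ∣ p ∣ ≡ suc s
  to (inj₁ (p , eq)) = inside ∷ p , cong suc eq
  to (inj₂ (p , eq)) = outside ∷ p , eq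
  from : (Σ[ p ∈ Subset (suc m) ] ∣ p ∣ ≡ suc s) →
         (Σ[ p ∈ Subset m ] ∣ p ∣ ≡ s) ⊎ (Σ[ p ∈ Subset m ] ∣ p ∣ ≡ suc s)
  from (inside ∷ p , eq)  = inj₁ (p , cong pred eq)
  from (outside ∷ p , eq) = inj₂ (p , eq)
  to-from : ∀ x → to (from x) ≡ x
  to-from (inside ∷ p , eq)  = cong (inside ∷ p ,_) (≡-irrelevant _ _)
  to-from (outside ∷ p , eq) = refl
  from-to : ∀ x → from (to x) ≡ x
  from-to (inj₁ (p , eq)) = cong (λ e → inj₁ (p , e)) (≡-irrelevant _ _)
  from-to (inj₂ (p , eq)) = refl

-- Double counting of a relation

indicator : Bool → ℕ
indicator true  = 1
indicator false = 0

∣p∣≡∑ : (p : Subset n) → ∣ p ∣ ≡ sum (λ i → indicator (lookup p i))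
∣p∣≡∑ []            = refl
∣p∣≡∑ (inside ∷ p)  = cong suc (∣p∣≡∑ p)
∣p∣≡∑ (outside ∷ p) = ∣p∣≡∑ p

sum≤∣p∣* : (p : Subset n) (g : Fin n → ℕ) (b : ℕ) →
  (∀ i → i ∈ p → g i ≤ b) → (∀ i → i ∉ p → g i ≡ 0) → sum g ≤ ∣ p ∣ * b
sum≤∣p∣* []            g b _  _  = z≤n
sum≤∣p∣* (inside ∷ p)  g b on off =
  +-mono-≤ (on zero here) (sum≤∣p∣* p (g ∘ suc) b (λ i i∈ → on (suc i) (there i∈))
    (λ i i∉ → off (suc i) (i∉ ∘ drop-there)))
sum≤∣p∣* (outside ∷ p) g b on off rewrite off zero (λ ()) =
  sum≤∣p∣* p (g ∘ suc) b (λ i i∈ → on (suc i) (there i∈)) (λ i i∉ → off (suc i) (i∉ ∘ drop-there))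

∣p∣*≤sum : (p : Subset n) (g : Fin n → ℕ) (b : ℕ) → (∀ i → i ∈ p → b ≤ g i) → ∣ p ∣ * b ≤ sum g
∣p∣*≤sum []            g b _  = z≤n
∣p∣*≤sum (inside ∷ p)  g b on =
  +-mono-≤ (on zero here) (∣p∣*≤sum p (g ∘ suc) b (λ i i∈ → on (suc i) (there i∈)))
∣p∣*≤sum (outside ∷ p) g b on =
  m≤n⇒m≤o+n (g zero) (∣p∣*≤sum p (g ∘ suc) b (λ i i∈ → on (suc i) (there i∈)))

double-counting : {R : Fin m → Fin n → Set} (R? : ∀ i j → Dec (R i j)) (p : Subset m) (q : Subset n) (a b : ℕ) →
  (∀ i → i ∈ p → ∣ ⟪ R? i ⟫ ∩ q ∣ ≤ a) → (∀ j → j ∈ q → b ≤ ∣ ⟪ (λ i → R? i j) ⟫ ∩ p ∣) →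
  ∣ q ∣ * b ≤ ∣ p ∣ * a
double-counting {m} {n} {R} R? p q a b rows columns = begin
  ∣ q ∣ * b                                   ≤⟨ ∣p∣*≤sum q _ b columns′ ⟩
  sum (λ j → sum (λ i → indicator (M i j)))  ≡⟨ ∑-comm (λ i j → indicator (M i j)) ⟨
  sum (λ i → sum (λ j → indicator (M i j)))  ≤⟨ sum≤∣p∣* p _ a rows′ off ⟩
  ∣ p ∣ * a                                   ∎
  where
  open ≤-Reasoning
  -- Cutting the relation down to `p` and `q` lets both sums run over all indices, so that `∑-comm`
  -- applies.
  M? : ∀ i j → Dec (i ∈ p × j ∈ q × R i j)
  M? i j = (i ∈? p) ×-dec ((j ∈? q) ×-dec R? i j)
  M : Fin m → Fin n → Bool
  M i j = ⌊ M? i j ⌋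
  ∑≡∣⟪⟫∣ : ∀ {n} {P : Fin n → Set} (P? : Decidable P) → sum (λ i → indicator ⌊ P? i ⌋) ≡ ∣ ⟪ P? ⟫ ∣
  ∑≡∣⟪⟫∣ {n} P? = trans (sum-cong-≗ {n} (λ i → cong indicator (sym (lookup∘tabulate (λ i → ⌊ P? i ⌋) i)))) (sym (∣p∣≡∑ ⟪ P? ⟫))
  rows′ : ∀ i → i ∈ p → sum (λ j → indicator (M i j)) ≤ a
  rows′ i i∈p = begin
    sum (λ j → indicator (M i j)) ≡⟨ ∑≡∣⟪⟫∣ (M? i) ⟩
    ∣ ⟪ M? i ⟫ ∣                  ≤⟨ p⊆q⇒∣p∣≤∣q∣ (λ j∈ → let (_ , j∈q , rij) = ∈⟪⟫⁻ (M? i) j∈ in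
                                       x∈p∩q⁺ (∈⟪⟫⁺ (R? i) rij , j∈q)) ⟩
    ∣ ⟪ R? i ⟫ ∩ q ∣              ≤⟨ rows i i∈p ⟩
    a                             ∎
  off : ∀ i → i ∉ p → sum (λ j → indicator (M i j)) ≡ 0
  off i i∉p = n≤0⇒n≡0 (begin
    sum (λ j → indicator (M i j)) ≡⟨ ∑≡∣⟪⟫∣ (M? i) ⟩
    ∣ ⟪ M? i ⟫ ∣                  ≤⟨ p⊆q⇒∣p∣≤∣q∣ {q = ⊥} (λ j∈ → ⊥-elim (i∉p (proj₁ (∈⟪⟫⁻ (M? i) j∈)))) ⟩
    ∣ ⊥ {n} ∣                     ≡⟨ ∣⊥∣≡0 n ⟩
    0                             ∎)
  columns′ : ∀ j → j ∈ q → b ≤ sum (λ i → indicator (M i j))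
  columns′ j j∈q = begin
    b                                   ≤⟨ columns j j∈q ⟩
    ∣ ⟪ (λ i → R? i j) ⟫ ∩ p ∣          ≤⟨ p⊆q⇒∣p∣≤∣q∣ (λ i∈ → let (i∈R , i∈p) = x∈p∩q⁻ _ _ i∈ in
                                             ∈⟪⟫⁺ (λ i → M? i j) (i∈p , j∈q , ∈⟪⟫⁻ (λ i → R? i j) i∈R)) ⟩
    ∣ ⟪ (λ i → M? i j) ⟫ ∣              ≡⟨ ∑≡∣⟪⟫∣ (λ i → M? i j) ⟨
    sum (λ i → indicator (M i j))       ∎

-- Reachability, cuts and k-connectedness

module _ {H : Subgraph n} {S : Subset n} where

  Reach-source : ∀ {u v} → Reach H S u v → u ∈ V H × u ∉ S
  Reach-source (here u∈ u∉)     = u∈ , u∉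
  Reach-source (step u∈ u∉ _ _) = u∈ , u∉

  Reach-trans : ∀ {u v w} → Reach H S u v → Reach H S v w → Reach H S u w
  Reach-trans (here _ _)       q = q
  Reach-trans (step u∈ u∉ e p) q = step u∈ u∉ e (Reach-trans p q)

  Reach-edge : ∀ {u v} → T (E H u v) → u ∉ S → v ∉ S → Reach H S u v
  Reach-edge {u} {v} e u∉ v∉ with E-inV H u v e
  ... | u∈ , v∈ = step u∈ u∉ e (here v∈ v∉)

  Reach-sym : ∀ {u v} → Reach H S u v → Reach H S v u
  Reach-sym (here u∈ u∉)     = here u∈ u∉
  Reach-sym (step u∈ u∉ e p) =
    Reach-trans (Reach-sym p) (Reach-edge (E-sym H _ _ e) (proj₂ (Reach-source p)) u∉)

  Reach-hub : ∀ h → (∀ u → u ∈ V H → u ∉ S → Reach H S u h) → ConnectedMinus H S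
  Reach-hub h toHub u v u∈ u∉ v∈ v∉ = Reach-trans (toHub u u∈ u∉) (Reach-sym (toHub v v∈ v∉))

Closed : Subgraph n → Subset n → Subset n → Set
Closed H S A = ∀ a w → a ∈ A → T (E H a w) → w ∉ S → w ∈ A

Closed-Reach : ∀ {H : Subgraph n} {S A u v} → Closed H S A → Reach H S u v → u ∈ A → v ∈ A
Closed-Reach closed (here _ _)     u∈A = u∈A
Closed-Reach closed (step _ _ e p) u∈A =
  Closed-Reach closed p (closed _ _ u∈A e (proj₂ (Reach-source p)))

-- Grows a set from `u` by one new neighbour at a time. Since `∣ A ∣` increases in every round and
-- never exceeds `n`, the invariant `n < ∣ A ∣ + fuel` keeps `fuel` from running out.
component : (H : Subgraph n) (S : Subset n) (u : Fin n) → u ∈ V H → u ∉ S →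
  Σ[ A ∈ Subset n ] (u ∈ A × (∀ {a} → a ∈ A → Reach H S u a) × Closed H S A)
component {n} H S u u∈V u∉S = grow n ⁅ u ⁆ (≤-reflexive (cong (_+ n) (sym (∣⁅x⁆∣≡1 u))))
  (x∈⁅x⁆ u) (λ a∈ → subst (Reach H S u) (sym (x∈⁅y⁆⇒x≡y u a∈)) (here u∈V u∉S))
  where
  grow : ∀ fuel A → n < ∣ A ∣ + fuel → u ∈ A → (∀ {a} → a ∈ A → Reach H S u a) →
    Σ[ A ∈ Subset n ] (u ∈ A × (∀ {a} → a ∈ A → Reach H S u a) × Closed H S A)
  grow zero A lt _ _ =
    contradiction (∣p∣≤n A) (<⇒≱ (subst (n <_) (+-identityʳ ∣ A ∣) lt))
  grow (suc fuel) A lt u∈A reach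
    with any? (λ a → any? (λ w → (a ∈? A) ×-dec (T? (E H a w) ×-dec (¬? (w ∈? S) ×-dec ¬? (w ∈? A)))))
  ... | no none = A , u∈A , reach , λ a w a∈A e w∉S →
    decidable-stable (w ∈? A) (λ w∉A → none (a , w , a∈A , e , w∉S , w∉A))
  ... | yes (a , w , a∈A , e , w∉S , w∉A) =
    grow fuel (A ∪ ⁅ w ⁆) lt′ (p⊆p∪q ⁅ w ⁆ u∈A) reach′
    where
    lt′ : n < ∣ A ∪ ⁅ w ⁆ ∣ + fuel
    lt′ = ≤-trans lt (≤-trans (≤-reflexive (+-suc ∣ A ∣ fuel)) (+-monoˡ-≤ fuel
      (p⊂q⇒∣p∣<∣q∣ (p⊆p∪q ⁅ w ⁆ , w , q⊆p∪q A ⁅ w ⁆ (x∈⁅x⁆ w) , w∉A))))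
    reach′ : ∀ {b} → b ∈ A ∪ ⁅ w ⁆ → Reach H S u b
    reach′ {b} b∈ with x∈p∪q⁻ A ⁅ w ⁆ b∈
    ... | inj₁ b∈A = reach b∈A
    ... | inj₂ b∈w = subst (Reach H S u) (sym (x∈⁅y⁆⇒x≡y w b∈w))
      (Reach-trans (reach a∈A) (Reach-edge e (proj₂ (Reach-source (Reach-sym (reach a∈A)))) w∉S))

Reach? : (H : Subgraph n) (S : Subset n) (u v : Fin n) → Dec (Reach H S u v)
Reach? H S u v with (u ∈? V H) ×-dec ¬? (u ∈? S)
... | no ¬source = no (¬source ∘ Reach-source)
... | yes (u∈V , u∉S) with component H S u u∈V u∉S
...   | A , u∈A , reach , closed = map′ reach (λ p → Closed-Reach closed p u∈A) (v ∈? A)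

-- A concrete witness that k-connectedness fails. The side `A` is recorded as a closed set rather
-- than through unreachability, because the later counting needs both sides as sets.
record Cut (k : ℕ) (H : Subgraph n) : Set where
  field
    S A    : Subset n
    S⊆V    : S ⊆ V H
    ∣S∣<k  : ∣ S ∣ < k
    A⊆V∖S  : ∀ {a} → a ∈ A → a ∈ V H × a ∉ S
    closed : Closed H S A
    u v    : Fin n
    u∈A    : u ∈ A
    v∈V    : v ∈ V H
    v∉S    : v ∉ S
    v∉A    : v ∉ A

Cut⇒¬KConnected : ∀ {k} {H : Subgraph n} → Cut k H → ¬ KConnected k H
Cut⇒¬KConnected cut (_ , conn) = v∉A (Closed-Reach closed
  (conn S S⊆V ∣S∣<k u v (proj₁ (A⊆V∖S u∈A)) (proj₂ (A⊆V∖S u∈A)) v∈V v∉S) u∈A)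
  where open Cut cut

-- Reachability is decidable, so all `S`, `u`, `v` can be searched for a separated pair; the
-- component of `u` is then the side `A`.
KConnected⊎Cut : ∀ k (H : Subgraph n) → suc k ≤ ∣V∣ H → KConnected k H ⊎ Cut k H
KConnected⊎Cut {n} k H k<∣V∣
  with anySubset? (λ S → (S ⊆? V H) ×-dec ((∣ S ∣ <? k) ×-dec any? (λ u → any? (λ v →
         ((u ∈? V H) ×-dec ¬? (u ∈? S)) ×-dec (((v ∈? V H) ×-dec ¬? (v ∈? S)) ×-dec ¬? (Reach? H S u v))))))
... | no none = inj₁ (k<∣V∣ , λ S S⊆V S<k u v u∈ u∉ v∈ v∉ → decidable-stable (Reach? H S u v)
  (λ ¬reach → none (S , S⊆V , S<k , u , v , (u∈ , u∉) , (v∈ , v∉) , ¬reach)))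
... | yes (S , S⊆V , S<k , u , v , (u∈ , u∉) , (v∈ , v∉) , ¬reach) with component H S u u∈ u∉
...   | A , u∈A , reach , closed = inj₂ (record
  { S = S ; A = A ; S⊆V = S⊆V ; ∣S∣<k = S<k
  ; A⊆V∖S = λ a∈A → Reach-source (Reach-sym (reach a∈A))
  ; closed = closed ; u = u ; v = v ; u∈A = u∈A ; v∈V = v∈ ; v∉S = v∉
  ; v∉A = λ v∈A → ¬reach (reach v∈A) })

KConnected? : ∀ k (H : Subgraph n) → Dec (KConnected k H)
KConnected? k H with suc k ≤? ∣V∣ H
... | no ¬big = no (¬big ∘ proj₁)
... | yes big with KConnected⊎Cut k H big
...   | inj₁ conn = yes conn
...   | inj₂ cut  = no (Cut⇒¬KConnected cut)

-- Deleting all neighbours of i would isolate it.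
low-degree⇒∉V : ∀ {k} {H : Subgraph n} → KConnected k H → (D : Subset n) → ∣ D ∣ < k →
  ∀ i → (∀ j → T (E H i j) → j ∈ D) → i ∉ V H
low-degree⇒∉V {n} {k} {H} (big , conn) D D<k i N⊆D i∈V = isolated (conn N N⊆V N<k i j i∈V i∉N j∈V j∉N)
  where
  N : Subset n
  N = ⟪ (λ j → T? (E H i j)) ⟫
  edge : ∀ {j} → j ∈ N → T (E H i j)
  edge = ∈⟪⟫⁻ (λ j → T? (E H i j))
  N⊆V : N ⊆ V H
  N⊆V j∈N = proj₂ (E-inV H _ _ (edge j∈N))
  N<k : ∣ N ∣ < k
  N<k = ≤-<-trans (p⊆q⇒∣p∣≤∣q∣ (λ j∈N → N⊆D _ (edge j∈N))) D<k
  i∉N : i ∉ N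
  i∉N i∈N = E-irr H i i (edge i∈N) refl
  -- `V H` has more than `k` vertices, while `⁅ i ⁆ ∪ N` has at most `k`.
  other : ∃ λ j → j ∈ V H × j ∉ ⁅ i ⁆ ∪ N
  other = ∣p∣<∣q∣⇒∃q∖p (⁅ i ⁆ ∪ N) (V H)
    (<-≤-trans (s≤s (≤-trans (∪-bound ⁅ i ⁆ N (≤-reflexive (∣⁅x⁆∣≡1 i)) ≤-refl) N<k)) big)
  j : Fin n
  j = proj₁ other
  j∈V : j ∈ V H
  j∈V = proj₁ (proj₂ other)
  j∉N : j ∉ N
  j∉N = proj₂ (∉∪ ⁅ i ⁆ N (proj₂ (proj₂ other)))
  isolated : ¬ Reach H N i j
  isolated path with j in eq | path
  ... | _ | here _ _     = proj₁ (∉∪ ⁅ i ⁆ N (proj₂ (proj₂ other))) (subst (_∈ ⁅ i ⁆) (sym eq) (x∈⁅x⁆ i))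
  ... | _ | step _ _ e p = proj₂ (Reach-source p) (∈⟪⟫⁺ (λ j → T? (E H i j)) e)

-- Subgraphs given by a set of colours, and existence of the maximum

module _ (f : Colouring n r) where

  colourGraph-edge? : ∀ K U i j → Dec ((i ∈ U × j ∈ U) × i ≢ j × col f i j ∈ K)
  colourGraph-edge? K U i j = ((i ∈? U) ×-dec (j ∈? U)) ×-dec (¬? (i ≟F j) ×-dec (col f i j ∈? K))

  colourGraph : Subset r → Subset n → Subgraph n
  colourGraph K U = record
    { V     = U
    ; E     = λ i j → ⌊ colourGraph-edge? K U i j ⌋
    ; E-sym = λ i j e → let ((i∈ , j∈) , i≢j , c∈) = toWitness e in
        fromWitness ((j∈ , i∈) , i≢j ∘ sym , subst (_∈ K) (col-sym f i j) c∈)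
    ; E-irr = λ i j e → proj₁ (proj₂ (toWitness e))
    ; E-inV = λ i j e → proj₁ (toWitness e)
    }

  usedColours⁺ : (H : Subgraph n) → ∀ {i j} → T (E H i j) → col f i j ∈ usedColours f H
  usedColours⁺ H e = ∈⟪⟫⁺ (λ c → any? (λ i → any? (λ j → T? (E H i j) ×-dec (col f i j ≟F c)))) (_ , _ , e , refl)

  ∣usedColours∣≤ : ∀ K U → c[ f ] (colourGraph K U) ≤ ∣ K ∣
  ∣usedColours∣≤ K U = p⊆q⇒∣p∣≤∣q∣ {q = K} λ c∈ →
    let (i , j , e , eq) = ∈⟪⟫⁻ (λ c → any? (λ i → any? (λ j →
                             T? (E (colourGraph K U) i j) ×-dec (col f i j ≟F c)))) c∈
    in subst (_∈ K) eq (proj₂ (proj₂ (toWitness {a? = colourGraph-edge? K U i j} e)))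

  -- Extra edges preserve k-connectedness, so an admissible subgraph may be replaced by the full
  -- colour graph on its vertices and used colours.
  KConnected-colourGraph : ∀ {k} (H : Subgraph n) → KConnected k H →
    KConnected k (colourGraph (usedColours f H) (V H))
  KConnected-colourGraph {k} H (big , conn) =
    big , λ S S⊆V S<k u v u∈ u∉ v∈ v∉ → lift (conn S S⊆V S<k u v u∈ u∉ v∈ v∉)
    where
    lift : ∀ {S u v} → Reach H S u v → Reach (colourGraph (usedColours f H) (V H)) S u v
    lift (here u∈ u∉)     = here u∈ u∉
    lift (step u∈ u∉ e p) =
      step u∈ u∉ (fromWitness (E-inV H _ _ e , E-irr H _ _ e , usedColours⁺ H e)) (lift p)

  -- Descends from `b`, testing all pairs of a vertex set of the current size and a set of at most
  -- `s` colours. By `KConnected-colourGraph` this finite search misses no size.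
  IsM-exists : ∀ s k b → (∀ H → Good f s k H → ∣V∣ H ≤ b) → Σ[ w ∈ ℕ ] (IsM f s k w × w ≤ b)
  IsM-exists s k zero    bound = 0 , (inj₁ refl , bound) , z≤n
  IsM-exists s k (suc b) bound
    with anySubset? (λ U → (∣ U ∣ ≟ suc b) ×-dec
           anySubset? (λ K → (∣ K ∣ ≤? s) ×-dec KConnected? k (colourGraph K U)))
  ... | yes (U , ∣U∣≡ , K , K≤s , conn) =
    suc b , (inj₂ (colourGraph K U , (conn , ≤-trans (∣usedColours∣≤ K U) K≤s) , ∣U∣≡) , bound) , ≤-refl
  ... | no none =
    let (w , isM , w≤b) = IsM-exists s k b λ H (conn , K≤s) →
          s≤s⁻¹ (≤∧≢⇒< (bound H (conn , K≤s)) λ ∣V∣≡ →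
            none (V H , ∣V∣≡ , usedColours f H , K≤s , KConnected-colourGraph H conn))
    in w , isM , m≤n⇒m≤1+n w≤b

-- Lower bound

∁-large : ∀ {a b} (p : Subset n) → ∣ p ∣ ≤ b → a + b ≤ n → a ≤ ∣ ∁ p ∣
∁-large {n} {a} {b} p p≤b a+b≤n = +-cancelʳ-≤ ∣ p ∣ a (∣ ∁ p ∣)
  (≤-trans (+-monoʳ-≤ a p≤b) (≤-trans a+b≤n (≤-reflexive (sym (∣∁p∣+∣p∣≡n p)))))

∁-covers : ∀ {b} (p : Subset n) → ∣ p ∣ ≤ b → n ≤ ∣ ∁ p ∣ + b
∁-covers p p≤b = ≤-trans (≤-reflexive (sym (∣∁p∣+∣p∣≡n p))) (+-monoʳ-≤ ∣ ∁ p ∣ p≤b)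

module _ (f : Colouring n r) (K : Subset r) (t : ℕ) (8t+2≤n : 8 * t + 2 ≤ n) where

  open Data.Nat.Solver.+-*-Solver

  N? : ∀ i → Decidable (λ j → col f i j ∈ K)
  N? i j = col f i j ∈? K

  -- Red neighbours, `K` being the red colours. `N i` may contain `i`, as the diagonal is coloured
  -- too, but it is only compared with sets that avoid `i`.
  N : Fin n → Subset n
  N i = ⟪ N? i ⟫

  N-sym : ∀ {i j} → i ∈ N j → j ∈ N i
  N-sym {i} {j} i∈ = ∈⟪⟫⁺ (N? i) (subst (_∈ K) (col-sym f j i) (∈⟪⟫⁻ (N? j) i∈))

  blue-edge : ∀ {U i j} → i ∈ U → j ∈ U → i ≢ j → j ∉ N i → T (E (colourGraph f (∁ K) U) i j)
  blue-edge {i = i} i∈ j∈ i≢j j∉N =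
    fromWitness ((i∈ , j∈) , i≢j , x∉p⇒x∈∁p (j∉N ∘ ∈⟪⟫⁺ (N? i)))

  Sparse : Subset n → Set
  Sparse X = ∀ {x} → x ∈ X → ∣ N x ∩ ∁ X ∣ ≤ t

  LargeKConnected : Set
  LargeKConnected = Σ[ U ∈ Subset n ] (n ≤ ∣ U ∣ + 2 * t ×
    (KConnected (suc t) (colourGraph f K U) ⊎ KConnected (suc t) (colourGraph f (∁ K) U)))

  -- All edges between the two sides A and ∁ (X ∪ (S ∪ A)) of the cut are blue, and every vertex
  -- of X has a blue neighbour on one of the sides after deleting t vertices.
  balanced-cut : ∀ X S A → Sparse X → ∣ X ∣ ≤ 2 * t → ∣ S ∣ ≤ t →
    (∀ {a} → a ∈ A → a ∉ X × a ∉ S) →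
    (∀ {a j} → a ∈ A → j ∉ X → j ∉ S → j ∉ A → j ∉ N a) →
    t < ∣ A ∣ → t < ∣ ∁ (X ∪ (S ∪ A)) ∣ → KConnected (suc t) (colourGraph f (∁ K) (∁ S))
  balanced-cut X S A sparse X≤2t S≤t A-avoids A-closed t<A t<B = big , conn
    where
    H = colourGraph f (∁ K) (∁ S)
    big : suc (suc t) ≤ ∣ ∁ S ∣
    big = ∁-large S S≤t (begin
      2 + t + t                     ≤⟨ m≤m+n (2 + t + t) (6 * t) ⟩
      2 + t + t + 6 * t             ≡⟨ solve 1 (λ t → con 2 :+ t :+ t :+ con 6 :* t := con 8 :* t :+ con 2) refl t ⟩
      8 * t + 2                     ≤⟨ 8t+2≤n ⟩
      n                             ∎)
      where open ≤-Reasoning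
    conn : ∀ D → D ⊆ ∁ S → ∣ D ∣ < suc t → ConnectedMinus H D
    conn D _ (s≤s D≤t)
      with ∣p∣<∣q∣⇒∃q∖p D A (≤-<-trans D≤t t<A) | ∣p∣<∣q∣⇒∃q∖p D (∁ (X ∪ (S ∪ A))) (≤-<-trans D≤t t<B)
    ... | a , a∈A , a∉D | b , b∈B , b∉D with ∉∪ X (S ∪ A) (x∈∁p⇒x∉p b∈B)
    ...   | b∉X , b∉S∪A with ∉∪ S A b∉S∪A
    ...     | b∉S , b∉A = Reach-hub b toHub
      where
      a→b : ∀ {u} → u ∈ A → u ∉ D → Reach H D u b
      a→b u∈A u∉D = Reach-edge (blue-edge (x∉p⇒x∈∁p (proj₂ (A-avoids u∈A))) (x∉p⇒x∈∁p b∉S)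
        (λ { refl → b∉A u∈A }) (A-closed u∈A b∉X b∉S b∉A)) u∉D b∉D
      -- A vertex of `A` reaches `b` directly, one of the other side through `a`; only edges between
      -- the sides are used.
      toHub∖X : ∀ u → u ∉ X → u ∉ S → u ∉ D → Reach H D u b
      toHub∖X u u∉X u∉S u∉D with u ∈? A
      ... | yes u∈A = a→b u∈A u∉D
      ... | no u∉A = Reach-trans
        (Reach-edge (blue-edge (x∉p⇒x∈∁p u∉S) (x∉p⇒x∈∁p (proj₂ (A-avoids a∈A)))
          (λ { refl → u∉A a∈A }) (A-closed a∈A u∉X u∉S u∉A ∘ N-sym)) u∉D a∉D)
        (a→b a∈A a∉D)
      toHub : ∀ u → u ∈ ∁ S → u ∉ D → Reach H D u b
      toHub u u∈∁S u∉D with u ∈? X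
      ... | no u∉X = toHub∖X u u∉X (x∈∁p⇒x∉p u∈∁S) u∉D
      ... | yes u∈X with ∣p∣<∣q∣⇒∃q∖p (S ∪ ((N u ∩ ∁ X) ∪ D)) (∁ X) room
        where
        room : ∣ S ∪ ((N u ∩ ∁ X) ∪ D) ∣ < ∣ ∁ X ∣
        room = <-≤-trans (s≤s (∪-bound S _ S≤t (∪-bound (N u ∩ ∁ X) D (sparse u∈X) D≤t)))
          (∁-large X X≤2t (begin
            1 + (t + (t + t)) + 2 * t               ≤⟨ m≤m+n _ (3 * t + 1) ⟩
            1 + (t + (t + t)) + 2 * t + (3 * t + 1) ≡⟨ solve 1 (λ t → con 1 :+ (t :+ (t :+ t)) :+ con 2 :* t :+ (con 3 :* t :+ con 1)
                                                         := con 8 :* t :+ con 2) refl t ⟩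
            8 * t + 2                               ≤⟨ 8t+2≤n ⟩
            n                                       ∎))
          where open ≤-Reasoning
      ...   | j , j∈∁X , j∉ with ∉∪ S _ j∉
      ...     | j∉S , j∉′ with ∉∪ (N u ∩ ∁ X) D j∉′
      ...       | j∉N , j∉D = Reach-trans
        (Reach-edge (blue-edge u∈∁S (x∉p⇒x∈∁p j∉S) (λ { refl → x∈∁p⇒x∉p j∈∁X u∈X })
          (λ j∈N → j∉N (x∈p∩q⁺ (j∈N , j∈∁X)))) u∉D j∉D)
        (toHub∖X j (x∈∁p⇒x∉p j∈∁X) j∉S j∉D)

  -- Even after `t` deletions, any two remaining vertices of `X` have a common blue neighbour
  -- outside `X`, and every other remaining vertex has a blue neighbour in `X`, once `Bad` is
  -- removed.
  large-sparse : ∀ X → Sparse X → 2 * t ≤ ∣ X ∣ → suc ∣ X ∣ ≤ 3 * t → LargeKConnected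
  large-sparse X sparse 2t≤X X<3t = ∁ Bad , ∁-covers Bad Bad≤2t , inj₂ (big , conn)
    where
    -- The vertices outside X with at most t blue neighbours in X.
    Bad? : Decidable (λ w → w ∉ X × ∣ X ∣ ≤ t + ∣ N w ∩ X ∣)
    Bad? w = ¬? (w ∈? X) ×-dec (∣ X ∣ ≤? t + ∣ N w ∩ X ∣)
    Bad : Subset n
    Bad = ⟪ Bad? ⟫
    H = colourGraph f (∁ K) (∁ Bad)

    1≤t : 1 ≤ t
    1≤t = pos t X<3t
      where
      pos : ∀ t → suc ∣ X ∣ ≤ 3 * t → 1 ≤ t
      pos zero    ()
      pos (suc t) _ = s≤s z≤n

    t+t≤X : t + t ≤ ∣ X ∣
    t+t≤X = ≤-trans (≤-reflexive (cong (λ x → t + x) (sym (+-identityʳ t)))) 2t≤X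

    t<X : t < ∣ X ∣
    t<X = ≤-trans (+-monoˡ-≤ t 1≤t) t+t≤X

    -- A bad vertex has at least `∣ X ∣ ∸ t` red neighbours in `X`, while a vertex of `X` has at
    -- most `t` in `Bad`.
    Bad*≤ : ∣ Bad ∣ * (∣ X ∣ ∸ t) ≤ ∣ X ∣ * t
    Bad*≤ = double-counting N? X Bad t (∣ X ∣ ∸ t)
      (λ x x∈X → ≤-trans (p⊆q⇒∣p∣≤∣q∣ (λ w∈ → let (w∈N , w∈Bad) = x∈p∩q⁻ (N x) Bad w∈ in
        x∈p∩q⁺ (w∈N , x∉p⇒x∈∁p (proj₁ (∈⟪⟫⁻ Bad? w∈Bad))))) (sparse x∈X))
      (λ w w∈Bad → ≤-trans (m≤n+o⇒m∸n≤o ∣ X ∣ t (proj₂ (∈⟪⟫⁻ Bad? w∈Bad)))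
        (p⊆q⇒∣p∣≤∣q∣ (λ {x} x∈ → let (x∈N , x∈X) = x∈p∩q⁻ (N w) X x∈ in
          x∈p∩q⁺ (∈⟪⟫⁺ (λ x → N? x w) (∈⟪⟫⁻ (N? x) (N-sym x∈N)) , x∈X))))

    -- With `d = ∣ X ∣ ∸ t`, the assumption `2 * t ≤ ∣ X ∣` gives `t ≤ d`, hence
    -- `∣ X ∣ * t ≤ 2 * t * d`, and `d` cancels.
    Bad≤2t : ∣ Bad ∣ ≤ 2 * t
    Bad≤2t = *-cancelʳ-≤ ∣ Bad ∣ (2 * t) d {{>-nonZero (≤-trans 1≤t t≤d)}} (begin
      ∣ Bad ∣ * d      ≤⟨ Bad*≤ ⟩
      ∣ X ∣ * t        ≡⟨ cong (_* t) (m∸n+n≡m (<⇒≤ t<X)) ⟨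
      (d + t) * t      ≡⟨ solve 2 (λ d t → (d :+ t) :* t := t :* d :+ t :* t) refl d t ⟩
      t * d + t * t    ≤⟨ +-monoʳ-≤ (t * d) (*-monoʳ-≤ t t≤d) ⟩
      t * d + t * d    ≡⟨ solve 2 (λ d t → t :* d :+ t :* d := con 2 :* t :* d) refl d t ⟩
      2 * t * d        ∎)
      where
      open ≤-Reasoning
      d = ∣ X ∣ ∸ t
      t≤d : t ≤ d
      t≤d = m+n≤o⇒m≤o∸n t t+t≤X

    big : suc (suc t) ≤ ∣ ∁ Bad ∣
    big = ∁-large Bad Bad≤2t (begin
      2 + t + 2 * t           ≤⟨ m≤m+n _ (5 * t) ⟩
      2 + t + 2 * t + 5 * t   ≡⟨ solve 1 (λ t → con 2 :+ t :+ con 2 :* t :+ con 5 :* t := con 8 :* t :+ con 2) refl t ⟩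
      8 * t + 2               ≤⟨ 8t+2≤n ⟩
      n                       ∎)
      where open ≤-Reasoning

    X⊆∁Bad : ∀ {x} → x ∈ X → x ∈ ∁ Bad
    X⊆∁Bad x∈X = x∉p⇒x∈∁p (λ x∈Bad → proj₁ (∈⟪⟫⁻ Bad? x∈Bad) x∈X)

    conn : ∀ D → D ⊆ ∁ Bad → ∣ D ∣ < suc t → ConnectedMinus H D
    conn D _ (s≤s D≤t) with ∣p∣<∣q∣⇒∃q∖p D X (≤-<-trans D≤t t<X)
    ... | h , h∈X , h∉D = Reach-hub h toHub
      where
      fromX : ∀ {x} → x ∈ X → x ∉ D → Reach H D x h
      fromX {x} x∈X x∉D
        -- Seeks a common blue neighbour of `x` and `h`. Fewer than `3t + 2t + 3t` vertices are
        -- excluded, which is where `8 * t` comes from.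
        with ∣p∣<∣q∣⇒∃q∖p (X ∪ (Bad ∪ (D ∪ ((N x ∩ ∁ X) ∪ (N h ∩ ∁ X))))) ⊤ room
        where
        room : ∣ X ∪ (Bad ∪ (D ∪ ((N x ∩ ∁ X) ∪ (N h ∩ ∁ X)))) ∣ < ∣ ⊤ {n} ∣
        room = begin
          1 + ∣ X ∪ (Bad ∪ (D ∪ ((N x ∩ ∁ X) ∪ (N h ∩ ∁ X)))) ∣
            ≤⟨ s≤s (∪-bound X _ ≤-refl (∪-bound Bad _ Bad≤2t (∪-bound D _ D≤t
                 (∪-bound (N x ∩ ∁ X) (N h ∩ ∁ X) (sparse x∈X) (sparse h∈X))))) ⟩
          1 + ∣ X ∣ + (2 * t + (t + (t + t)))
            ≤⟨ +-monoˡ-≤ _ X<3t ⟩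
          3 * t + (2 * t + (t + (t + t)))
            ≤⟨ m≤m+n _ 2 ⟩
          3 * t + (2 * t + (t + (t + t))) + 2
            ≡⟨ solve 1 (λ t → con 3 :* t :+ (con 2 :* t :+ (t :+ (t :+ t))) :+ con 2 := con 8 :* t :+ con 2) refl t ⟩
          8 * t + 2
            ≤⟨ 8t+2≤n ⟩
          n
            ≡⟨ ∣⊤∣≡n n ⟨
          ∣ ⊤ {n} ∣ ∎
          where open ≤-Reasoning
      ... | w , _ , w∉ with ∉∪ X _ w∉
      ...   | w∉X , w∉₁ with ∉∪ Bad _ w∉₁
      ...     | w∉Bad , w∉₂ with ∉∪ D _ w∉₂
      ...       | w∉D , w∉₃ with ∉∪ (N x ∩ ∁ X) (N h ∩ ∁ X) w∉₃
      ...         | w∉Nx , w∉Nh = Reach-trans (link x∈X x∉D w∉Nx) (Reach-sym (link h∈X h∉D w∉Nh))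
        where
        link : ∀ {y} → y ∈ X → y ∉ D → w ∉ N y ∩ ∁ X → Reach H D y w
        link y∈X y∉D w∉Ny = Reach-edge (blue-edge (X⊆∁Bad y∈X) (x∉p⇒x∈∁p w∉Bad) (λ { refl → w∉X y∈X })
          (λ w∈N → w∉Ny (x∈p∩q⁺ (w∈N , x∉p⇒x∈∁p w∉X)))) y∉D w∉D
      toHub : ∀ u → u ∈ ∁ Bad → u ∉ D → Reach H D u h
      toHub u u∈∁Bad u∉D with u ∈? X
      ... | yes u∈X = fromX u∈X u∉D
      -- As `u` is not bad, `t + ∣ N u ∩ X ∣ < ∣ X ∣`, so a blue neighbour of `u` in `X` survives
      -- the deletion of `D`.
      ... | no u∉X with ∣p∣<∣q∣⇒∃q∖p (D ∪ (N u ∩ X)) X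
                         (≤-<-trans (∪-bound D (N u ∩ X) D≤t ≤-refl)
                           (≰⇒> (λ X≤ → x∈∁p⇒x∉p u∈∁Bad (∈⟪⟫⁺ Bad? (u∉X , X≤)))))
      ...   | x , x∈X , x∉ with ∉∪ D (N u ∩ X) x∉
      ...     | x∉D , x∉N = Reach-trans
        (Reach-edge (blue-edge u∈∁Bad (X⊆∁Bad x∈X) (λ { refl → u∉X x∈X })
          (λ x∈N → x∉N (x∈p∩q⁺ (x∈N , x∈X)))) u∉D x∉D)
        (fromX x∈X x∉D)

  -- Induction on `fuel`, which drops as `X` grows. The bound `2 * t ∸ 1` means `∣ X ∣ < 2 * t`,
  -- except that it also admits the empty `X` when `t` is 0.
  peel : ∀ fuel X → 2 * t < ∣ X ∣ + fuel → Sparse X → ∣ X ∣ ≤ 2 * t ∸ 1 → LargeKConnected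
  peel zero X lt _ X≤ = contradiction (≤-trans X≤ (m∸n≤m (2 * t) 1))
    (<⇒≱ (subst (2 * t <_) (+-identityʳ ∣ X ∣) lt))
  peel (suc fuel) X lt sparse X≤ with KConnected⊎Cut (suc t) (colourGraph f K (∁ X)) big
    where
    big : suc (suc t) ≤ ∣ ∁ X ∣
    big = ∁-large X (≤-trans X≤ (m∸n≤m (2 * t) 1)) (begin
      2 + t + 2 * t           ≤⟨ m≤m+n _ (5 * t) ⟩
      2 + t + 2 * t + 5 * t   ≡⟨ solve 1 (λ t → con 2 :+ t :+ con 2 :* t :+ con 5 :* t := con 8 :* t :+ con 2) refl t ⟩
      8 * t + 2               ≤⟨ 8t+2≤n ⟩
      n                       ∎)
      where open ≤-Reasoning
  ... | inj₁ conn = ∁ X , ∁-covers X (≤-trans X≤ (m∸n≤m (2 * t) 1)) , inj₁ conn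
  ... | inj₂ cut = split (t <? ∣ A ∣) (t <? ∣ B ∣)
    where
    open Cut cut
    B : Subset n
    B = ∁ (X ∪ (S ∪ A))

    S≤t : ∣ S ∣ ≤ t
    S≤t = s≤s⁻¹ ∣S∣<k

    A-avoids : ∀ {a} → a ∈ A → a ∉ X × a ∉ S
    A-avoids a∈A = x∈∁p⇒x∉p (proj₁ (A⊆V∖S a∈A)) , proj₂ (A⊆V∖S a∈A)

    A-closed : ∀ {a j} → a ∈ A → j ∉ X → j ∉ S → j ∉ A → j ∉ N a
    A-closed {a} {j} a∈A j∉X j∉S j∉A j∈N = j∉A (closed a j a∈A
      (fromWitness ((proj₁ (A⊆V∖S a∈A) , x∉p⇒x∈∁p j∉X) , (λ { refl → j∉A a∈A }) , ∈⟪⟫⁻ (N? a) j∈N)) j∉S)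

    B-avoids : ∀ {b} → b ∈ B → b ∉ X × b ∉ S × b ∉ A
    B-avoids b∈B = let (b∉X , b∉) = ∉∪ X (S ∪ A) (x∈∁p⇒x∉p b∈B) in b∉X , ∉∪ S A b∉

    ∈B : ∀ {j} → j ∉ X → j ∉ S → j ∉ A → j ∈ B
    ∈B j∉X j∉S j∉A = x∉p⇒x∈∁p λ j∈ → [ j∉X , (λ j∈′ → [ j∉S , j∉A ]′ (x∈p∪q⁻ S A j∈′)) ]′ (x∈p∪q⁻ X (S ∪ A) j∈)

    -- For a small side `Y` of the cut: its red neighbours outside `X ∪ Y` lie in `S`, so `X ∪ Y` is
    -- again sparse, and `y` makes it strictly larger than `X`.
    absorb : ∀ Y y → y ∈ Y → ∣ Y ∣ ≤ t → (∀ {y} → y ∈ Y → y ∉ X) →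
      (∀ {y j} → y ∈ Y → j ∉ X → j ∉ Y → j ∈ N y → j ∈ S) → LargeKConnected
    absorb Y y y∈Y Y≤t Y-avoids N⊆S = finish (2 * t ≤? ∣ X ∪ Y ∣)
      where
      1≤t : 1 ≤ t
      1≤t = ≤-trans (subst (_≤ ∣ Y ∣) (∣⁅x⁆∣≡1 y)
        (p⊆q⇒∣p∣≤∣q∣ (λ z∈ → subst (_∈ Y) (sym (x∈⁅y⁆⇒x≡y y z∈)) y∈Y))) Y≤t

      sparse′ : Sparse (X ∪ Y)
      sparse′ {x} x∈ with x∈p∪q⁻ X Y x∈
      ... | inj₁ x∈X = ≤-trans (p⊆q⇒∣p∣≤∣q∣ (λ j∈ → let (j∈N , j∉XY) = x∈p∩q⁻ (N x) (∁ (X ∪ Y)) j∈ in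
        x∈p∩q⁺ (j∈N , x∉p⇒x∈∁p (proj₁ (∉∪ X Y (x∈∁p⇒x∉p j∉XY)))))) (sparse x∈X)
      ... | inj₂ x∈Y = ≤-trans (p⊆q⇒∣p∣≤∣q∣ (λ j∈ →
        let (j∈N , j∉XY) = x∈p∩q⁻ (N x) (∁ (X ∪ Y)) j∈
            (j∉X , j∉Y)  = ∉∪ X Y (x∈∁p⇒x∉p j∉XY)
        in N⊆S x∈Y j∉X j∉Y j∈N)) S≤t

      finish : Dec (2 * t ≤ ∣ X ∪ Y ∣) → LargeKConnected
      -- The bounds on `X` and `Y` give `∣ X ∪ Y ∣ < 3 * t`; `1 ≤ t` makes the truncated subtraction
      -- exact.
      finish (yes 2t≤) = large-sparse (X ∪ Y) sparse′ 2t≤ (begin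
        1 + ∣ X ∪ Y ∣            ≤⟨ s≤s (∪-bound X Y X≤ Y≤t) ⟩
        1 + (2 * t ∸ 1) + t      ≡⟨ cong (_+ t) (m+[n∸m]≡n (≤-trans 1≤t (m≤m+n t (1 * t)))) ⟩
        2 * t + t                ≡⟨ solve 1 (λ t → con 2 :* t :+ t := con 3 :* t) refl t ⟩
        3 * t                    ∎)
        where open ≤-Reasoning
      finish (no 2t≰) = peel fuel (X ∪ Y)
        (≤-trans lt (≤-trans (≤-reflexive (+-suc ∣ X ∣ fuel)) (+-monoˡ-≤ fuel
          (p⊂q⇒∣p∣<∣q∣ (p⊆p∪q Y , y , q⊆p∪q X Y y∈Y , Y-avoids y∈Y)))))
        sparse′ (m+n≤o⇒m≤o∸n ∣ X ∪ Y ∣ (≤-trans (≤-reflexive (+-comm ∣ X ∪ Y ∣ 1)) (≰⇒> 2t≰)))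

    split : Dec (t < ∣ A ∣) → Dec (t < ∣ B ∣) → LargeKConnected
    split (no t≮A) _ = absorb A u u∈A (≮⇒≥ t≮A) (proj₁ ∘ A-avoids)
      (λ {a} {j} a∈A j∉X j∉A j∈N → decidable-stable (j ∈? S) (λ j∉S → A-closed a∈A j∉X j∉S j∉A j∈N))
    -- `v` shows that `B` is nonempty, and a red edge from `B` to `A` would contradict that `A` is
    -- closed.
    split (yes _) (no t≮B) = absorb B v (∈B (x∈∁p⇒x∉p v∈V) v∉S v∉A) (≮⇒≥ t≮B) (proj₁ ∘ B-avoids)
      (λ {b} {j} b∈B j∉X j∉B j∈N → decidable-stable (j ∈? S) (λ j∉S → j∉B (∈B j∉X j∉S (λ j∈A →
        let (b∉X , b∉S , b∉A) = B-avoids b∈B in A-closed j∈A b∉X b∉S b∉A (N-sym j∈N)))))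
    split (yes t<A) (yes t<B) = ∁ S ,
      ∁-covers S (≤-trans S≤t (m≤m+n t (1 * t))) ,
      inj₂ (balanced-cut X S A sparse (≤-trans X≤ (m∸n≤m (2 * t) 1)) S≤t A-avoids A-closed t<A t<B)

  large-KConnected : LargeKConnected
  large-KConnected = peel (suc (2 * t)) ⊥ (m≤n+m _ ∣ ⊥ {n} ∣) (λ x∈ → ⊥-elim (∉⊥ x∈))
    (≤-trans (≤-reflexive (∣⊥∣≡0 n)) z≤n)

-- Extremal colourings

-- The choice is made for `toℕ i ≤ toℕ j` and mirrored otherwise, which makes `colour` symmetric
-- even if `choice` is not.
prescribed-colouring : (P : Fin n → Fin n → Fin r → Set) → (∀ {i j c} → P i j c → P j i c) →
  (∀ i j → ∃ (P i j)) → Σ[ f ∈ Colouring n r ] (∀ i j → P i j (col f i j))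
prescribed-colouring {n} {r} P P-sym choice = record { col = colour ; sym = colour-sym } , colour-P
  where
  pick : ∀ i j → Dec (toℕ i ≤ toℕ j) → ∃ (P i j)
  pick i j (yes _) = choice i j
  pick i j (no _)  = proj₁ (choice j i) , P-sym (proj₂ (choice j i))
  colour : Fin n → Fin n → Fin r
  colour i j = proj₁ (pick i j (toℕ i ≤? toℕ j))
  colour-P : ∀ i j → P i j (colour i j)
  colour-P i j = proj₂ (pick i j (toℕ i ≤? toℕ j))
  colour-sym : ∀ i j → colour i j ≡ colour j i
  colour-sym i j with toℕ i ≤? toℕ j | toℕ j ≤? toℕ i
  ... | yes i≤j | yes j≤i with refl ← toℕ-injective (≤-antisym i≤j j≤i) = refl
  ... | yes _   | no _    = refl
  ... | no _    | yes _   = refl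
  ... | no i≰j  | no j≰i  = contradiction (<⇒≤ (≰⇒> i≰j)) j≰i

module SizedSubsets (m s : ℕ) where

  private module I = Inverse (subsetsOfSize m s)

  abstract
    subset : Fin (m C s) → Subset m
    subset q = proj₁ (I.to q)

    ∣subset∣ : ∀ q → ∣ subset q ∣ ≡ s
    ∣subset∣ q = proj₂ (I.to q)

    index : (p : Subset m) → ∣ p ∣ ≡ s → ∃ λ q → subset q ≡ p
    index p ∣p∣≡s = I.from (p , ∣p∣≡s) , cong proj₁ (I.strictlyInverseˡ (p , ∣p∣≡s))

    subset-injective : ∀ {q q′} → subset q ≡ subset q′ → q ≡ q′
    subset-injective {q} {q′} eq = trans (sym (I.strictlyInverseʳ q))
      (trans (cong I.from (ext (I.to q) (I.to q′) eq)) (I.strictlyInverseʳ q′))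
      where
      ext : (x y : Σ[ p ∈ Subset m ] ∣ p ∣ ≡ s) → proj₁ x ≡ proj₁ y → x ≡ y
      ext (p , e) (.p , e′) refl = cong (p ,_) (≡-irrelevant e e′)

-- The extremal colouring with 2s colours

module _ (s′ t : ℕ) (large : ((2 * suc s′) C suc s′) * (2 * t) ≤ n) where

  private
    s = suc s′

  open SizedSubsets (2 * s) s

  Q : Set
  Q = Fin ((2 * s) C s)

  -- Class, half and position are packed into one number, so the classes are disjoint blocks of
  -- `2 * t` vertices; `large` fits them into `Fin n`.
  place : Q → Fin 2 → Fin t → Fin n
  place q a j = inject≤ (combine q (combine a j)) large

  At : Fin n → Q → Fin 2 → Set
  At i q a = ∃ λ j → i ≡ place q a j

  At-unique : ∀ {i} q a q′ a′ → At i q a → At i q′ a′ → q ≡ q′ × a ≡ a′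
  At-unique q a q′ a′ (j , refl) (j′ , eq)
    with combine-injective q (combine a j) q′ (combine a′ j′) (inject≤-injective large large _ _ eq)
  ... | q≡q′ , eq′ = q≡q′ , proj₁ (combine-injective a j a′ j′ eq′)

  -- Half of each class is matched with a half of the complementary class;
  -- colour 0 singles out one of the two complementary subsets.
  partner : Subset (2 * s) → Fin 2 → Fin 2
  partner p a with zero ∈? p
  ... | yes _ = a
  ... | no _  = opposite a

  partner-∈ : ∀ p a → zero ∈ p → partner p a ≡ a
  partner-∈ p a z∈ with zero ∈? p
  ... | yes _ = refl
  ... | no z∉ = contradiction z∈ z∉

  partner-∉ : ∀ p a → zero ∉ p → partner p a ≡ opposite a
  partner-∉ p a z∉ with zero ∈? p
  ... | yes z∈ = contradiction z∈ z∉
  ... | no _   = refl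

  ∣∁subset∣ : ∀ q → ∣ ∁ (subset q) ∣ ≡ s
  ∣∁subset∣ q = trans (∣∁p∣≡n∸∣p∣ (subset q)) (trans (cong (2 * s ∸_) (∣subset∣ q))
    (trans (m+n∸m≡n s (1 * s)) (*-identityˡ s)))

  -- The condition at the end `i` of the edge `ij`: a colour in the set of the class of `i` may only
  -- lead to one half, `t` vertices, of the complementary class. Vertices in no class are
  -- unconstrained.
  Confined : Fin n → Fin n → Fin (2 * s) → Set
  Confined i j c = ∀ q a → At i q a → c ∈ subset q →
    ∃ λ q′ → subset q′ ≡ ∁ (subset q) × At j q′ (partner (subset q) a)

  ∉⇒Confined : ∀ {i j c} q a → At i q a → c ∉ subset q → Confined i j c
  ∉⇒Confined q a at c∉ q′ a′ at′ c∈ with refl , _ ← At-unique q a q′ a′ at at′ = contradiction c∈ c∉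

  ≢⇒opposite : (a b : Fin 2) → a ≢ b → a ≡ opposite b
  ≢⇒opposite zero       zero       a≢b = contradiction refl a≢b
  ≢⇒opposite zero       (suc zero) _   = refl
  ≢⇒opposite (suc zero) zero       _   = refl
  ≢⇒opposite (suc zero) (suc zero) a≢b = contradiction refl a≢b

  -- Each colour lies in exactly one of the two sets, so one end must permit it. If `a ≡ b`, the end
  -- in class `p` permits `zero`; otherwise the other end permits any colour of `p′`, because
  -- `partner` swaps halves there.
  complementary-choice : ∀ p p′ → p′ ≡ ∁ p → ∣ p′ ∣ ≡ s → zero ∈ p → (a b : Fin 2) →
    ∃ λ c → (c ∈ p → b ≡ partner p a) × (c ∈ p′ → a ≡ partner p′ b)
  complementary-choice p p′ refl ∣p′∣≡s z∈p a b with a ≟F b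
  ... | yes refl = zero , (λ _ → sym (partner-∈ p a z∈p)) , λ z∈ → contradiction z∈p (x∈∁p⇒x∉p z∈)
  ... | no a≢b with ∣p∣<∣q∣⇒∃q∖p ⊥ p′ (subst₂ _<_ (sym (∣⊥∣≡0 (2 * s))) (sym ∣p′∣≡s) (s≤s z≤n))
  ...   | c , c∈ , _ = c , (λ c∈p → contradiction c∈p (x∈∁p⇒x∉p c∈)) ,
    λ _ → trans (≢⇒opposite a b a≢b) (sym (partner-∉ p′ b (x∈p⇒x∉∁p z∈p)))

  confined-choice : ∀ i j → ∃ λ c → Confined i j c × Confined j i c
  confined-choice i j with located? i | located? j
    where
    located? : ∀ i → Dec (∃ λ q → ∃ λ a → At i q a)
    located? i = any? (λ q → any? (λ a → any? (λ x → i ≟F place q a x)))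
  -- Neither end is constrained, so `zero` is just a default.
  ... | no ¬i | no ¬j = zero , (λ q a at → contradiction (q , a , at) ¬i) , (λ q a at → contradiction (q , a , at) ¬j)
  ... | yes (q , a , at) | no ¬j
    with ∣p∣<∣q∣⇒∃q∖p ⊥ (∁ (subset q)) (subst₂ _<_ (sym (∣⊥∣≡0 (2 * s))) (sym (∣∁subset∣ q)) (s≤s z≤n))
  ...   | c , c∈ , _ = c , ∉⇒Confined q a at (x∈∁p⇒x∉p c∈) , (λ q a at → contradiction (q , a , at) ¬j)
  confined-choice i j | no ¬i | yes (q , a , at)
    with ∣p∣<∣q∣⇒∃q∖p ⊥ (∁ (subset q)) (subst₂ _<_ (sym (∣⊥∣≡0 (2 * s))) (sym (∣∁subset∣ q)) (s≤s z≤n))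
  ...   | c , c∈ , _ = c , (λ q a at → contradiction (q , a , at) ¬i) , ∉⇒Confined q a at (x∈∁p⇒x∉p c∈)
  confined-choice i j | yes (q , a , at) | yes (q′ , b , at′)
    with any? (λ c → ¬? (c ∈? subset q) ×-dec ¬? (c ∈? subset q′))
  ... | yes (c , c∉ , c∉′) = c , ∉⇒Confined q a at c∉ , ∉⇒Confined q′ b at′ c∉′
  -- No colour avoids both sets, so the two `s`-sets cover all `2 * s` colours and are complements.
  ... | no none = conclude (matched (zero ∈? subset q))
    where
    covered : ∀ {c} → c ∉ subset q → c ∈ subset q′
    covered {c} c∉ = decidable-stable (c ∈? subset q′) (λ c∉′ → none (c , c∉ , c∉′))
    covered′ : ∀ {c} → c ∉ subset q′ → c ∈ subset q
    covered′ {c} c∉′ = decidable-stable (c ∈? subset q) (λ c∉ → none (c , c∉ , c∉′))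
    q′≡∁q : subset q′ ≡ ∁ (subset q)
    q′≡∁q = sym (⊆∧∣q∣≤∣p∣⇒≡ (λ c∈ → covered (x∈∁p⇒x∉p c∈))
      (≤-reflexive (trans (∣subset∣ q′) (sym (∣∁subset∣ q)))))
    q≡∁q′ : subset q ≡ ∁ (subset q′)
    q≡∁q′ = sym (⊆∧∣q∣≤∣p∣⇒≡ (λ c∈ → covered′ (x∈∁p⇒x∉p c∈))
      (≤-reflexive (trans (∣subset∣ q) (sym (∣∁subset∣ q′)))))
    matched : Dec (zero ∈ subset q) →
      ∃ λ c → (c ∈ subset q → b ≡ partner (subset q) a) × (c ∈ subset q′ → a ≡ partner (subset q′) b)
    matched (yes z∈) = complementary-choice (subset q) (subset q′) q′≡∁q (∣subset∣ q′) z∈ a b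
    matched (no z∉)  =
      let (c , h , h′) = complementary-choice (subset q′) (subset q) q≡∁q′ (∣subset∣ q) (covered z∉) b a
      in c , h′ , h
    conclude : (∃ λ c → (c ∈ subset q → b ≡ partner (subset q) a) × (c ∈ subset q′ → a ≡ partner (subset q′) b)) →
      ∃ λ c → Confined i j c × Confined j i c
    conclude (c , h , h′) = c ,
      (λ q₁ a₁ at₁ c∈ → confine q a q₁ a₁ q′ b at at₁ c∈ at′ q′≡∁q h) ,
      (λ q₁ a₁ at₁ c∈ → confine q′ b q₁ a₁ q a at′ at₁ c∈ at q≡∁q′ h′)
      where
      confine : ∀ {i j} q a q₁ a₁ q′ b → At i q a → At i q₁ a₁ → c ∈ subset q₁ → At j q′ b →
        subset q′ ≡ ∁ (subset q) → (c ∈ subset q → b ≡ partner (subset q) a) →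
        ∃ λ q″ → subset q″ ≡ ∁ (subset q₁) × At j q″ (partner (subset q₁) a₁)
      confine {j = j} q a q₁ a₁ q′ b at at₁ c∈ at′ eq h with refl , refl ← At-unique q a q₁ a₁ at at₁ =
        q′ , eq , subst (At j q′) (h c∈) at′

  -- Let `p` be an `s`-set containing the used colours. A vertex in the class of `p` has all its
  -- neighbours in `H` within one half of the complementary class, so `low-degree⇒∉V` excludes it
  -- from `H`, and with it the whole class.
  extremal-colouring : Σ[ f ∈ Colouring n (2 * s) ] (∀ H → Good f s (suc t) H → ∣V∣ H + 2 * t ≤ n)
  extremal-colouring with prescribed-colouring (λ i j c → Confined i j c × Confined j i c) (λ (p , q) → q , p) confined-choice
  ... | f , confined = f , bound
    where
    bound : ∀ H → Good f s (suc t) H → ∣V∣ H + 2 * t ≤ n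
    bound H (conn , used≤s)
      with ⊆-extend (usedColours f H) s used≤s (m≤m+n s (1 * s))
    ... | p , ∣p∣≡s , used⊆p with index p ∣p∣≡s
    ...   | q , refl with index (∁ (subset q)) (∣∁subset∣ q)
    ...     | q* , q*≡∁q = begin
      ∣ V H ∣ + 2 * t          ≤⟨ +-monoʳ-≤ ∣ V H ∣ (injective⇒≤∣p∣ (∁ (V H)) member member-injective
                                   (λ x → x∉p⇒x∈∁p (member∉V x))) ⟩
      ∣ V H ∣ + ∣ ∁ (V H) ∣    ≡⟨ +-comm ∣ V H ∣ _ ⟩
      ∣ ∁ (V H) ∣ + ∣ V H ∣    ≡⟨ ∣∁p∣+∣p∣≡n (V H) ⟩
      n                        ∎
      where
      open ≤-Reasoning
      member : Fin (2 * t) → Fin n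
      member x = inject≤ (combine q x) large
      member-injective : ∀ x y → member x ≡ member y → x ≡ y
      member-injective x y eq = proj₂ (combine-injective q x q y (inject≤-injective large large _ _ eq))
      place∉V : ∀ a j → place q a j ∉ V H
      place∉V a j with image (place q* (partner (subset q) a))
      ... | D , D≤t , place∈D = low-degree⇒∉V conn D (s≤s D≤t) (place q a j) N⊆D
        where
        N⊆D : ∀ i → T (E H (place q a j) i) → i ∈ D
        N⊆D i e with proj₁ (confined (place q a j) i) q a (j , refl) (used⊆p (usedColours⁺ f H e))
        ... | q′ , q′≡∁q , x , refl with refl ← subset-injective {q′} {q*} (trans q′≡∁q (sym q*≡∁q)) = place∈D x
      member∉V : ∀ x → member x ∉ V H
      member∉V x with combine-surjective {2} {t} x
      ... | a , j , refl = place∉V a j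

-- A colouring with more than 2s colours

module _ (s : ℕ) (2s<r : 2 * s < r) .{{_ : NonZero (r C s)}} where

  open SizedSubsets r s

  classOf : Fin n → Fin (r C s)
  classOf i = toℕ i mod (r C s)

  avoiding-choice : (i j : Fin n) → ∃ λ c → c ∉ subset (classOf i) × c ∉ subset (classOf j)
  avoiding-choice i j
    with ∣p∣<∣q∣⇒∃q∖p (subset (classOf i) ∪ subset (classOf j)) ⊤ (begin-strict
      ∣ subset (classOf i) ∪ subset (classOf j) ∣
        ≤⟨ ∪-bound (subset (classOf i)) (subset (classOf j)) (≤-reflexive (∣subset∣ _)) (≤-reflexive (∣subset∣ _)) ⟩
      s + s       ≡⟨ cong (λ x → s + x) (+-identityʳ s) ⟨
      2 * s       <⟨ 2s<r ⟩
      r           ≡⟨ ∣⊤∣≡n r ⟨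
      ∣ ⊤ {r} ∣   ∎)
    where open ≤-Reasoning
  ... | c , _ , c∉ = c , ∉∪ (subset (classOf i)) (subset (classOf j)) c∉

  -- A vertex whose class is an `s`-set containing the used colours has no edge in `H`, so it lies
  -- outside `H`.
  avoiding-colouring : ∀ n → Σ[ f ∈ Colouring n r ] (∀ k → 1 ≤ k → ∀ H → Good f s k H → ∣V∣ H + n /ℕ (r C s) ≤ n)
  avoiding-colouring n
    with prescribed-colouring (λ i j c → c ∉ subset (classOf i) × c ∉ subset (classOf j)) (λ (p , q) → q , p) avoiding-choice
  ... | f , avoids = f , bound
    where
    bound : ∀ k → 1 ≤ k → ∀ H → Good f s k H → ∣V∣ H + n /ℕ (r C s) ≤ n
    bound k 1≤k H (conn , used≤s)
      with ⊆-extend (usedColours f H) s used≤s (≤-trans (m≤m+n s (1 * s)) (<⇒≤ 2s<r))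
    ... | p , ∣p∣≡s , used⊆p with index p ∣p∣≡s
    ...   | q , refl = begin
      ∣ V H ∣ + n /ℕ (r C s)   ≤⟨ +-monoʳ-≤ ∣ V H ∣ (injective⇒≤∣p∣ (∁ (V H)) member member-injective
                                   (λ x → x∉p⇒x∈∁p (member∉V x))) ⟩
      ∣ V H ∣ + ∣ ∁ (V H) ∣    ≡⟨ +-comm ∣ V H ∣ _ ⟩
      ∣ ∁ (V H) ∣ + ∣ V H ∣    ≡⟨ ∣∁p∣+∣p∣≡n (V H) ⟩
      n                        ∎
      where
      open ≤-Reasoning
      -- With `c = r C s`, the class of `q` contains `q`, `q + c`, `q + 2c` and so on; the first
      -- `n /ℕ c` of these are below `n` because `q < c`.
      member< : (x : Fin (n /ℕ (r C s))) → toℕ q + toℕ x * (r C s) < n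
      member< x = begin-strict
        toℕ q + toℕ x * (r C s)     <⟨ +-monoˡ-< _ (toℕ<n q) ⟩
        suc (toℕ x) * (r C s)       ≤⟨ *-monoˡ-≤ (r C s) (toℕ<n x) ⟩
        n /ℕ (r C s) * (r C s)      ≤⟨ m/n*n≤m n (r C s) ⟩
        n                           ∎
      member : Fin (n /ℕ (r C s)) → Fin n
      member x = fromℕ< (member< x)
      member-injective : ∀ x y → member x ≡ member y → x ≡ y
      member-injective x y eq = toℕ-injective (*-cancelʳ-≡ (toℕ x) (toℕ y) (r C s)
        (+-cancelˡ-≡ (toℕ q) _ _ (fromℕ<-injective _ _ (member< x) (member< y) eq)))
      class-member : ∀ x → classOf (member x) ≡ q
      class-member x = toℕ-injective (trans (toℕ-fromℕ< _) (trans (cong (_% (r C s)) (toℕ-fromℕ< (member< x)))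
        (trans ([m+kn]%n≡m%n (toℕ q) (toℕ x) (r C s)) (m<n⇒m%n≡m (toℕ<n q)))))
      member∉V : ∀ x → member x ∉ V H
      member∉V x = low-degree⇒∉V conn ⊥ (≤-trans (s≤s (≤-reflexive (∣⊥∣≡0 n))) 1≤k) (member x)
        (λ j e → contradiction (used⊆p (usedColours⁺ f H e))
          (subst (λ q → col f (member x) j ∉ subset q) (class-member x) (proj₁ (avoids (member x) j))))

-- The exact value for 2s colours

Ism-2s-colours : ∀ n s k → 1 ≤ s → 1 ≤ k → 2 ≤ n →
  2 * ((2 * s) C s) * (k ∸ 1) + 1 ≤ n → 13 * k ∸ 15 ≤ n → Ism n (2 * s) s k ((n + 2) ∸ 2 * k)
Ism-2s-colours n s@(suc s′) (suc t) _ _ 2≤n large 13k≤n = (f , isM f upper) , λ g w (_ , max) →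
  let (H , good , v≤) = lower g in ≤-trans v≤ (max H good)
  where
  open ≤-Reasoning
  -- For `t = suc u` the hypothesis reads `11 + 13 * u ≤ n`, which is stronger. For `t = 0` the
  -- truncated difference is 0, and `2 ≤ n` takes over.
  8t+2≤n : 8 * t + 2 ≤ n
  8t+2≤n = helper t 13k≤n
    where
    helper : ∀ t → 13 * suc t ∸ 15 ≤ n → 8 * t + 2 ≤ n
    helper zero    _ = 2≤n
    helper (suc u) h = begin
      8 * suc u + 2                  ≤⟨ m≤m+n _ (5 * u + 1) ⟩
      8 * suc u + 2 + (5 * u + 1)    ≡⟨ solve 1 (λ u → con 8 :* (con 1 :+ u) :+ con 2 :+ (con 5 :* u :+ con 1)
                                          := con 11 :+ con 13 :* u) refl u ⟩
      11 + 13 * u                    ≡⟨ m+n∸m≡n 15 (11 + 13 * u) ⟨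
      26 + 13 * u ∸ 15               ≡⟨ cong (_∸ 15) (solve 1 (λ u → con 26 :+ con 13 :* u := con 13 :* (con 2 :+ u)) refl u) ⟩
      13 * suc (suc u) ∸ 15          ≤⟨ h ⟩
      n                              ∎
      where open Data.Nat.Solver.+-*-Solver
  2k≡ : 2 * suc t ≡ 2 + 2 * t
  2k≡ = solve 1 (λ t → con 2 :* (con 1 :+ t) := con 2 :+ con 2 :* t) refl t
    where open Data.Nat.Solver.+-*-Solver
  v≡ : (n + 2) ∸ 2 * suc t ≡ n ∸ 2 * t
  v≡ = trans (cong₂ _∸_ (+-comm n 2) 2k≡) ([m+n]∸[m+o]≡n∸o 2 n (2 * t))
  -- Any `s`-set `K` serves: `∁ K` also has `s` colours, so a graph in either half is admissible.
  lower : (g : Colouring n (2 * s)) → Σ[ H ∈ Subgraph n ] (Good g s (suc t) H × (n + 2) ∸ 2 * suc t ≤ ∣V∣ H)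
  lower g with ⊆-extend {2 * s} ⊥ s (≤-trans (≤-reflexive (∣⊥∣≡0 (2 * s))) z≤n) (m≤m+n s (1 * s))
  ... | K , ∣K∣≡s , _ with large-KConnected g K t 8t+2≤n
  ...   | U , n≤ , conn = found conn
    where
    v≤ : (n + 2) ∸ 2 * suc t ≤ ∣ U ∣
    v≤ = ≤-trans (≤-reflexive v≡) (m≤n+o⇒m∸n≤o n (2 * t) (≤-trans n≤ (≤-reflexive (+-comm ∣ U ∣ (2 * t)))))
    ∣∁K∣≡s : ∣ ∁ K ∣ ≡ s
    ∣∁K∣≡s = trans (∣∁p∣≡n∸∣p∣ K) (trans (cong (2 * s ∸_) ∣K∣≡s)
      (trans (m+n∸m≡n s (1 * s)) (*-identityˡ s)))
    found : KConnected (suc t) (colourGraph g K U) ⊎ KConnected (suc t) (colourGraph g (∁ K) U) →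
      Σ[ H ∈ Subgraph n ] (Good g s (suc t) H × (n + 2) ∸ 2 * suc t ≤ ∣V∣ H)
    found (inj₁ conn) = colourGraph g K U , (conn , ≤-trans (∣usedColours∣≤ g K U) (≤-reflexive ∣K∣≡s)) , v≤
    found (inj₂ conn) = colourGraph g (∁ K) U , (conn , ≤-trans (∣usedColours∣≤ g (∁ K) U) (≤-reflexive ∣∁K∣≡s)) , v≤
  slots≤n : ((2 * s) C s) * (2 * t) ≤ n
  slots≤n = begin
    ((2 * s) C s) * (2 * t)          ≡⟨ solve 2 (λ c t → c :* (con 2 :* t) := con 2 :* c :* t) refl ((2 * s) C s) t ⟩
    2 * ((2 * s) C s) * t          ≤⟨ m≤m+n _ 1 ⟩
    2 * ((2 * s) C s) * t + 1      ≤⟨ large ⟩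
    n                            ∎
    where open Data.Nat.Solver.+-*-Solver
  f : Colouring n (2 * s)
  f = proj₁ (extremal-colouring s′ t slots≤n)
  upper : ∀ H → Good f s (suc t) H → ∣V∣ H ≤ (n + 2) ∸ 2 * suc t
  upper H good = ≤-trans (m+n≤o⇒m≤o∸n (∣V∣ H) (proj₂ (extremal-colouring s′ t slots≤n) H good)) (≤-reflexive (sym v≡))
  isM : ∀ f → (∀ H → Good f s (suc t) H → ∣V∣ H ≤ (n + 2) ∸ 2 * suc t) → IsM f s (suc t) ((n + 2) ∸ 2 * suc t)
  isM f upper = let (H , good , v≤) = lower f in inj₂ (H , good , ≤-antisym (upper H good) v≤) , upper

-- The strict linear bound for more than 2s colours

ℚ-bound : ∀ d .{{_ : NonZero d}} w n → d * w + n < d * n → (+ w / 1) <ℚ ((1ℚ - (+ 1 / d)) *ℚ (+ n / 1))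
ℚ-bound (suc d) w n lt = ℚ.toℚᵘ-cancel-< (ℚᵘ.<-respˡ-≃ (ℚᵘ.≃-sym (ℚ.toℚᵘ-fromℚᵘ w′))
  (ℚᵘ.<-respʳ-≃ (ℚᵘ.≃-sym rhs) (*<* (subst₂ ℤ._<_ eq₁ eq₂ (ℤ.+<+ lt′)))))
  where
  w′ n′ ε′ : ℚᵘ
  w′ = mkℚᵘ (+ w) 0
  n′ = mkℚᵘ (+ n) 0
  -- `mkℚᵘ` stores the denominator minus one, so this is `1 / suc d`.
  ε′ = mkℚᵘ (+ 1) d
  rhs : toℚᵘ ((1ℚ - (+ 1 / suc d)) *ℚ (+ n / 1)) ≃ᵘ (1ℚᵘ ℚᵘ.- ε′) ℚᵘ.* n′
  rhs = ℚᵘ.≃-trans (ℚ.toℚᵘ-homo-* (1ℚ - (+ 1 / suc d)) (+ n / 1))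
    (ℚᵘ.*-cong
      (ℚᵘ.≃-trans (ℚ.toℚᵘ-homo-+ 1ℚ (ℚ.- (+ 1 / suc d)))
        (ℚᵘ.+-congʳ 1ℚᵘ (ℚᵘ.≃-trans (ℚ.toℚᵘ-homo‿- (+ 1 / suc d)) (ℚᵘ.-‿cong (ℚ.toℚᵘ-fromℚᵘ ε′)))))
      (ℚ.toℚᵘ-fromℚᵘ n′))
  -- The claim in cross-multiplied form, as `1 - 1 / suc d` equals `d / suc d`.
  lt′ : w * suc d < d * n
  lt′ = +-cancelʳ-< n (w * suc d) (d * n)
    (subst₂ _<_ (cong (_+ n) (*-comm (suc d) w)) (+-comm n (d * n)) lt)
  eq₁ : + (w * suc d) ≡ + w ℤ.* ↧ ((1ℚᵘ ℚᵘ.- ε′) ℚᵘ.* n′)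
  eq₁ = trans (ℤ.pos-* w (suc d))
    (cong (λ x → + w ℤ.* + x) (sym (trans (*-identityʳ (1 * suc d)) (*-identityˡ (suc d)))))
  eq₂ : + (d * n) ≡ ↥ ((1ℚᵘ ℚᵘ.- ε′) ℚᵘ.* n′) ℤ.* + 1
  eq₂ = trans (ℤ.pos-* d n)
    (trans (cong (λ x → + x ℤ.* + n) (sym (+-identityʳ d))) (sym (ℤ.*-identityʳ _)))

0<1/ : ∀ d .{{_ : NonZero d}} → 0ℚ <ℚ (+ 1 / d)
0<1/ d = ℚ.positive⁻¹ (+ 1 / d) {{ℚ.normalize-pos 1 d}}

-- With `c = r C s`, at least `n /ℕ c` vertices are missed. Taking `ε = 1 / (2 * c)` absorbs the
-- rounding, since `n < 2 * c * (n /ℕ c)` for `n ≥ c`; neither `ε` nor the threshold `c` depends on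
-- `k`.
colouring-with-M<[1-ε]n : ∀ s r → 1 ≤ s → 2 * s < r →
  Σ ℚ λ ε → (0ℚ <ℚ ε) ×
    ((k : ℕ) → 1 ≤ k → Σ ℕ λ N → (n : ℕ) → N ≤ n → 2 ≤ n →
      Σ (Colouring n r) λ f → Σ ℕ λ w →
        IsM f s k w × ((+ w / 1) <ℚ ((1ℚ - ε) *ℚ (+ n / 1))))
colouring-with-M<[1-ε]n s r _ 2s<r = + 1 / (2 * c) , 0<1/ (2 * c) , λ k 1≤k → c , λ n c≤n _ →
  let (f , bound)     = avoiding-colouring s 2s<r n
      (w , isM , w≤)  = IsM-exists f s k (n ∸ n /ℕ c)
                          (λ H good → m+n≤o⇒m≤o∸n (∣V∣ H) (bound k 1≤k H good))
  in f , w , isM , ℚ-bound (2 * c) w n (arithmetic n w c≤n w≤)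
  where
  open ≤-Reasoning
  c = r C s
  instance
    -- As `s ≤ r`, some `s`-set of colours exists, and its index inhabits `Fin c`.
    c-nonZero : NonZero c
    c-nonZero = nonZero-Fin (proj₁ (SizedSubsets.index r s (proj₁ p) (proj₁ (proj₂ p))))
      where
      p = ⊆-extend {r} ⊥ s (≤-trans (≤-reflexive (∣⊥∣≡0 r)) z≤n) (≤-trans (m≤m+n s (1 * s)) (<⇒≤ 2s<r))
      nonZero-Fin : ∀ {N} → Fin N → NonZero N
      nonZero-Fin {suc _} _ = _
    2c-nonZero : NonZero (2 * c)
    2c-nonZero = m*n≢0 2 c
  arithmetic : ∀ n w → c ≤ n → w ≤ n ∸ n /ℕ c → 2 * c * w + n < 2 * c * n
  arithmetic n w c≤n w≤ = begin-strict
    2 * c * w + n                     <⟨ +-monoʳ-< (2 * c * w) n<2cq ⟩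
    2 * c * w + 2 * c * q             ≡⟨ *-distribˡ-+ (2 * c) w q ⟨
    2 * c * (w + q)                   ≤⟨ *-monoʳ-≤ (2 * c) (≤-trans (+-monoˡ-≤ q w≤) (≤-reflexive (m∸n+n≡m (m/n≤m n c)))) ⟩
    2 * c * n                         ∎
    where
    q = n /ℕ c
    n<2cq : n < 2 * c * q
    n<2cq = begin-strict
      n                ≡⟨ m≡m%n+[m/n]*n n c ⟩
      n % c + q * c    <⟨ +-monoˡ-< (q * c) (m%n<n n c) ⟩
      c + q * c        ≤⟨ +-monoˡ-≤ (q * c) (m≤n*m c q {{>-nonZero (m≥n⇒m/n>0 c≤n)}}) ⟩
      q * c + q * c    ≡⟨ solve 2 (λ q c → q :* c :+ q :* c := con 2 :* c :* q) refl q c ⟩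
      2 * c * q        ∎
      where open Data.Nat.Solver.+-*-Solver

theorem1p3 : ((n s k : ℕ) → 1 ≤ s → 1 ≤ k → 2 ≤ n →
    2 * ((2 * s) C s) * (k ∸ 1) + 1 ≤ n → 13 * k ∸ 15 ≤ n →
    Ism n (2 * s) s k ((n + 2) ∸ 2 * k))
    ×
    ((s r : ℕ) → 1 ≤ s → 2 * s < r →
    Σ ℚ λ ε → (0ℚ <ℚ ε) ×
    ((k : ℕ) → 1 ≤ k → Σ ℕ λ N → (n : ℕ) → N ≤ n → 2 ≤ n →
    Σ (Colouring n r) λ f → Σ ℕ λ w →
    IsM f s k w × ((+ w / 1) <ℚ ((1ℚ - ε) *ℚ (+ n / 1)))))
theorem1p3 = Ism-2s-colours , colouring-with-M<[1-ε]n
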